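{- Let $n$ be a positive integer, $k\ge2$ an integer, and $\beta$ an integer with $0\le\beta\le k-1$. Then $$\det_{0\le i,j\le n-1}\bigl(C_{(k-1)i+j+\beta,k}+C_{(k-1)i+j+\beta+1,k}\bigr)=\sum_{s=0}^{n}\binom{\lfloor\frac{s+\beta}{k-1}\rfloor+n}{n-s}.$$
   Context: For integers $k\ge2$ and $m\ge0$, the generalised Catalan number is $$C_{m,k}=\frac{m-(k-1)\lfloor\frac{m}{k-1}\rfloor+1}{m+\lfloor\frac{m}{k-1}\rfloor+1}\binom{m+\lfloor\frac{m}{k-1}\rfloor+1}{m+1}.$$ -}

module Defs where

open import Algebra.Bundles.Raw using (RawRing)
import Algebra.Definitions.RawMonoid as RawMonoidDefs
open import Data.Fin.Base using (Fin; zero; suc; toℕ; punchIn)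
open import Data.Integer.Base using (+_)
open import Data.Nat.Base as ℕ using (ℕ; zero; suc; 2+; _∸_; NonZero; NonTrivial)
open import Data.Nat.Combinatorics using () renaming (_C_ to binomial)
import Data.Nat.DivMod as ℕ
open import Data.Rational.Base as ℚ using (ℚ)
open import Level using (Level)

module Determinant {a ℓ : Level} (R : RawRing a ℓ) where
  open RawRing R
  open RawMonoidDefs +-rawMonoid using (sum)

  signed : ℕ → Carrier → Carrier
  signed zero    x = x
  signed (suc p) x = - signed p x

  -- Laplace expansion along row 0; `punchIn j` enumerates, in increasing
  -- order, the columns other than j.
  det : ∀ {n} → (Fin n → Fin n → Carrier) → Carrier
  det {zero}  M = 1#
  det {suc n} M =
    sum λ j → signed (toℕ j) (M zero j * det λ i l → M (suc i) (punchIn j l))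

open Determinant ℚ.+-*-rawRing public using () renaming (det to detℚ)

k-1-nonZero : ∀ k → .{{NonTrivial k}} → NonZero (k ∸ 1)
k-1-nonZero (2+ _) = _

⌊_/[_-1]⌋ : (m k : ℕ) → .{{NonTrivial k}} → ℕ
⌊ m /[ k -1]⌋ = ℕ._/_ m (k ∸ 1) {{k-1-nonZero k}}

fromℕ : ℕ → ℚ
fromℕ m = + m ℚ./ 1

-- The truncated subtraction is exact, since (k-1)⌊m/(k-1)⌋ ≤ m.
catalan : (m k : ℕ) → .{{NonTrivial k}} → ℚ
catalan m k =
  (+ (m ∸ (k ∸ 1) ℕ.* q ℕ.+ 1) ℚ./ suc (m ℕ.+ q))
    ℚ.* fromℕ (binomial (m ℕ.+ q ℕ.+ 1) (m ℕ.+ 1))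
  where
  q : ℕ
  q = ⌊ m /[ k -1]⌋

-- ∑≤ n f = f 0 + f 1 + ⋯ + f n, both bounds included.
∑≤ : ℕ → (ℕ → ℕ) → ℕ
∑≤ n f = sum {suc n} λ s → f (toℕ s)
  where open RawMonoidDefs ℕ.+-0-rawMonoid using (sum)

{-# OPTIONS --safe #-}
module Submission where

-- Write r = k - 1, q X = ⌊X/r⌋, and let S n be the sum on the right.
-- C_X is the ballot number of paths to (X, q X) staying in r y ≤ x.  Undoing the
-- ballot recurrence from (N, 0) up to that boundary gives
--   ∑_{X ≤ N} (-1)^(N-X) binom (q X) (N-X) C_X = 1,
-- that is, ∑ C_X u^X (1-u)^(q X) = 1/(1-u).  Multiplying by (1-u)^(n-i) and comparing
-- coefficients of u^(ri+β+n), one finds for 0 ≤ i ≤ n that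
--   ∑_{s ≤ n} (-1)^(n-s) binom (⌊(s+β)/r⌋ + n) (n-s) C_{ri+s+β} = [i = n].
-- Combining these relations for n and n + 1 by partial summation yields a combination
-- of the columns of the matrix of size n + 1 in which the last column has coefficient
-- S n and whose value is (0, …, 0, S (n+1)).  Cramer's rule turns this into
-- det_{n+1} · S n = S (n+1) · det_n, and S n ≠ 0.

open import Defs
open import Data.Fin.Base using (Fin; zero; suc; toℕ; punchIn)
open import Data.Integer.Base as ℤ using ()
import Data.Integer.Properties as ℤ
open import Data.List.Base using (List; []; _∷_; _++_; _∷ʳ_; [_]; tabulate; applyUpTo)
open import Data.List.Membership.Propositional using (_∈_)
open import Data.List.Membership.Propositional.Properties using (∈-∃++; ∈-applyUpTo⁺)
open import Data.List.Properties using (++-assoc; ∷ʳ-++; applyUpTo-∷ʳ)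
open import Data.Nat.Base as ℕ using (ℕ; zero; suc; 2+)
open import Data.Nat.Combinatorics using (_C_; nCk+nC[k+1]≡[n+1]C[k+1]; k>n⇒nCk≡0; nCk≡nC[n∸k]; nC1≡n)
open import Data.Nat.DivMod using (_/_; m≡m%n+[m/n]*n; m%n<n; m/n*n≤m; /-monoˡ-≤; m<n*o⇒m/o<n; m*n/n≡m; +-distrib-/-∣ˡ)
open import Data.Nat.Divisibility using (m∣m*n)
import Data.Nat.Properties as ℕ
open import Data.Product.Base using (_,_)
open import Data.Rational.Base as ℚ using (ℚ; 0ℚ; 1ℚ; fromℚᵘ)
import Data.Rational.Properties as ℚ
open import Data.Rational.Solver using (module +-*-Solver)
open import Data.Rational.Unnormalised.Base as ℚᵘ using (mkℚᵘ; *≡*)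
import Data.Rational.Unnormalised.Properties as ℚᵘ
open import Data.Sum.Base using ([_,_]′)
open import Function.Base using (_∘_)
open import Relation.Binary.PropositionalEquality using (_≡_; refl; sym; trans; cong; cong₂; subst; module ≡-Reasoning)
open +-*-Solver using (solve; _:=_; _:+_; _:*_; _:-_; :-_; con)
open ≡-Reasoning

-- Alternating sums.

module AlternatingSums where
  open import Data.Rational.Base using (_+_; _*_; _-_)

  -- The signs (-1)^(n-j) are counted from the last term, so the top term always enters with a plus
  -- and each recursion step is one subtraction, the shape that `minor-linear` treats.
  altSum : ℕ → (ℕ → ℚ) → ℚ
  altSum zero    f = f 0
  altSum (suc n) f = f (suc n) - altSum n f

  altSum-cong : ∀ n {f g} → (∀ j → j ℕ.≤ n → f j ≡ g j) → altSum n f ≡ altSum n g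
  altSum-cong zero    f≡g = f≡g 0 ℕ.z≤n
  altSum-cong (suc n) f≡g = cong₂ _-_ (f≡g (suc n) ℕ.≤-refl) (altSum-cong n λ j j≤n → f≡g j (ℕ.m≤n⇒m≤1+n j≤n))

  altSum-linear : ∀ n a b f g → altSum n (λ j → a * f j + b * g j) ≡ a * altSum n f + b * altSum n g
  altSum-linear zero    a b f g = refl
  altSum-linear (suc n) a b f g = trans
    (cong (λ s → a * f (suc n) + b * g (suc n) - s) (altSum-linear n a b f g))
    (solve 6 (λ a b f g s t → a :* f :+ b :* g :- (a :* s :+ b :* t) := a :* (f :- s) :+ b :* (g :- t)) refl
      a b (f (suc n)) (g (suc n)) (altSum n f) (altSum n g))

  altSum-zero : ∀ n {f} → (∀ j → j ℕ.≤ n → f j ≡ 0ℚ) → altSum n f ≡ 0ℚ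
  altSum-zero zero    f≡0 = f≡0 0 ℕ.z≤n
  altSum-zero (suc n) f≡0 = cong₂ _-_ (f≡0 (suc n) ℕ.≤-refl) (altSum-zero n λ j j≤n → f≡0 j (ℕ.m≤n⇒m≤1+n j≤n))

  altSum-last : ∀ n {f} → (∀ j → j ℕ.< n → f j ≡ 0ℚ) → altSum n f ≡ f n
  altSum-last zero    f≡0 = refl
  altSum-last (suc n) {f} f≡0 = trans
    (cong (λ s → f (suc n) - s) (altSum-zero n λ j j≤n → f≡0 j (ℕ.s≤s j≤n))) (ℚ.+-identityʳ (f (suc n)))

  altSum-shift : ∀ m n f → (∀ j → j ℕ.< m → f j ≡ 0ℚ) → altSum (n ℕ.+ m) f ≡ altSum n (λ j → f (j ℕ.+ m))
  altSum-shift m zero    f f≡0 = altSum-last m f≡0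
  altSum-shift m (suc n) f f≡0 = cong (λ s → f (suc n ℕ.+ m) - s) (altSum-shift m n f f≡0)

-- Determinants of lists of columns and Cramer's rule.

module Minors where
  open AlternatingSums
  open import Algebra.Properties.Monoid.Sum ℚ.+-0-monoid using (sum; sum-cong-≗)
  open Determinant ℚ.+-*-rawRing using (signed)
  open import Data.Rational.Base using (_+_; _*_; _-_; -_)

  -- Rows are indexed by all of ℕ, so one column serves determinants of every size.
  Column : Set
  Column = ℕ → ℚ

  -- minor n r cs is the determinant of the rows r, …, r + n - 1 of the columns cs.
  -- It is 0 when cs does not have n entries, so that the laws below need no
  -- hypothesis on lengths.  In expand n r ps cs, the columns ps have already been
  -- passed by the expansion along row r.
  minor  : ℕ → ℕ → List Column → ℚ
  expand : ℕ → ℕ → List Column → List Column → ℚ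

  minor zero    r []      = 1ℚ
  minor zero    r (_ ∷ _) = 0ℚ
  minor (suc n) r cs      = expand n r [] cs

  expand n r ps []       = 0ℚ
  expand n r ps (c ∷ cs) = c r * minor n (suc r) (ps ++ cs) - expand n r (ps ∷ʳ c) cs

  sum-neg : ∀ {n} (t : Fin n → ℚ) → sum (λ j → - t j) ≡ - sum t
  sum-neg {zero}  t = refl
  sum-neg {suc n} t =
    trans (cong (- t zero +_) (sum-neg (t ∘ suc))) (sym (ℚ.neg-distrib-+ (t zero) (sum (t ∘ suc))))

  -- Passing a column moves it into `ps`, and the sign gained by all later terms becomes the
  -- subtraction in `expand`.
  expand-tabulate : ∀ n r ps {m} (f : Fin (suc m) → Column) →
    sum (λ j → signed (toℕ j) (f j r * minor n (suc r) (ps ++ tabulate (f ∘ punchIn j))))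
      ≡ expand n r ps (tabulate f)
  expand-tabulate n r ps {zero}  f = refl
  expand-tabulate n r ps {suc m} f = cong (f zero r * minor n (suc r) (ps ++ tabulate (f ∘ suc)) +_) (begin
    sum (λ j → - signed (toℕ j) (term (ps ++ f zero ∷ rest j) j))
      ≡⟨ sum-neg (λ j → signed (toℕ j) (term (ps ++ f zero ∷ rest j) j)) ⟩
    - sum (λ j → signed (toℕ j) (term (ps ++ f zero ∷ rest j) j))
      ≡⟨ cong -_ (sum-cong-≗ λ j → cong (λ cs → signed (toℕ j) (term cs j)) (sym (∷ʳ-++ ps (f zero) (rest j)))) ⟩
    - sum (λ j → signed (toℕ j) (term (ps ∷ʳ f zero ++ rest j) j))
      ≡⟨ cong -_ (expand-tabulate n r (ps ∷ʳ f zero) (f ∘ suc)) ⟩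
    - expand n r (ps ∷ʳ f zero) (tabulate (f ∘ suc)) ∎)
    where
    rest : Fin (suc m) → List Column
    rest j = tabulate (f ∘ suc ∘ punchIn j)
    term : List Column → Fin (suc m) → ℚ
    term cs j = f (suc j) r * minor n (suc r) cs

  det≡minor : ∀ n r (M : Fin n → Fin n → ℚ) (f : Fin n → Column) →
    (∀ i j → M i j ≡ f j (toℕ i ℕ.+ r)) → detℚ M ≡ minor n r (tabulate f)
  det≡minor zero    r M f M≡f = refl
  det≡minor (suc n) r M f M≡f = trans
    (sum-cong-≗ λ j → cong (signed (toℕ j)) (cong₂ _*_ (M≡f zero j)
      (det≡minor n (suc r) _ (f ∘ punchIn j) λ i l →
        trans (M≡f (suc i) (punchIn j l)) (cong (f (punchIn j l)) (sym (ℕ.+-suc (toℕ i) r))))))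
    (expand-tabulate n r [] f)

  tabulate∘toℕ : ∀ {A : Set} (f : ℕ → A) n → tabulate {n = n} (f ∘ toℕ) ≡ applyUpTo f n
  tabulate∘toℕ f zero    = refl
  tabulate∘toℕ f (suc n) = cong (f 0 ∷_) (tabulate∘toℕ (f ∘ suc) n)

  -- Simultaneous induction on the expansion: the adjacent pair lies among the columns already
  -- passed (`expand-swapˡ`) or among those still ahead (`expand-swapʳ`).
  minor-swap : ∀ n r as x y bs →
    minor n r (as ++ x ∷ y ∷ bs) ≡ - minor n r (as ++ y ∷ x ∷ bs)
  expand-swapˡ : ∀ n r as x y bs cs →
    expand n r (as ++ x ∷ y ∷ bs) cs ≡ - expand n r (as ++ y ∷ x ∷ bs) cs
  expand-swapʳ : ∀ n r ps as x y bs →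
    expand n r ps (as ++ x ∷ y ∷ bs) ≡ - expand n r ps (as ++ y ∷ x ∷ bs)

  minor-swap zero    r []      x y bs = refl
  minor-swap zero    r (_ ∷ _) x y bs = refl
  minor-swap (suc n) r as      x y bs = expand-swapʳ n r [] as x y bs

  expand-swapˡ n r as x y bs []       = refl
  expand-swapˡ n r as x y bs (c ∷ cs)
    rewrite ++-assoc as (x ∷ y ∷ bs) cs | ++-assoc as (y ∷ x ∷ bs) cs
          | ++-assoc as (x ∷ y ∷ bs) [ c ] | ++-assoc as (y ∷ x ∷ bs) [ c ]
          | minor-swap n (suc r) as x y (bs ++ cs) | expand-swapˡ n r as x y (bs ∷ʳ c) cs
    = solve 3 (λ c m e → c :* (:- m) :- (:- e) := :- (c :* m :- e)) refl (c r) _ _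

  -- The expansion has reached the pair: the terms picking `x` and `y` occur on both sides with the
  -- same minors but opposite signs, and for the later terms both columns have been passed.
  expand-swapʳ n r ps [] x y bs
    rewrite ∷ʳ-++ ps x bs | ∷ʳ-++ ps y bs
          | ∷ʳ-++ ps x [ y ] | ∷ʳ-++ ps y [ x ] | expand-swapˡ n r ps x y [] bs
    = solve 5 (λ x y m m′ e → x :* m :- (y :* m′ :- (:- e)) := :- (y :* m′ :- (x :* m :- e))) refl
        (x r) (y r) _ _ _
  expand-swapʳ n r ps (a ∷ as) x y bs
    rewrite sym (++-assoc ps as (x ∷ y ∷ bs)) | sym (++-assoc ps as (y ∷ x ∷ bs))
          | minor-swap n (suc r) (ps ++ as) x y bs | expand-swapʳ n r (ps ∷ʳ a) as x y bs
    = solve 3 (λ c m e → c :* (:- m) :- (:- e) := :- (c :* m :- e)) refl (a r) _ _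

  x≡-x⇒x≡0 : ∀ {x} → x ≡ - x → x ≡ 0ℚ
  x≡-x⇒x≡0 {x} x≡-x = begin
    x                 ≡⟨ solve 1 (λ x → x := con ℚ.½ :* (x :+ x)) refl x ⟩
    ℚ.½ * (x + x)     ≡⟨ cong (λ y → ℚ.½ * (x + y)) x≡-x ⟩
    ℚ.½ * (x + (- x)) ≡⟨ solve 1 (λ x → con ℚ.½ :* (x :+ (:- x)) := con 0ℚ) refl x ⟩
    0ℚ                ∎

  -- Adjacent swaps carry the first copy of `x` up to the second; swapping two equal neighbours then
  -- makes the minor its own negative.
  minor-repeated : ∀ n r as x bs cs → minor n r (as ++ x ∷ bs ++ x ∷ cs) ≡ 0ℚ
  minor-repeated n r as x []       cs = x≡-x⇒x≡0 (minor-swap n r as x x cs)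
  minor-repeated n r as x (b ∷ bs) cs = begin
    minor n r (as ++ x ∷ b ∷ bs ++ x ∷ cs)     ≡⟨ minor-swap n r as x b (bs ++ x ∷ cs) ⟩
    - minor n r (as ++ b ∷ x ∷ bs ++ x ∷ cs)   ≡⟨ cong (λ ds → - minor n r ds) (∷ʳ-++ as b (x ∷ bs ++ x ∷ cs)) ⟨
    - minor n r (as ∷ʳ b ++ x ∷ bs ++ x ∷ cs)  ≡⟨ cong -_ (minor-repeated n r (as ∷ʳ b) x bs cs) ⟩
    0ℚ                                         ∎

  minor-∈-∷ʳ : ∀ n r {x cs} → x ∈ cs → minor n r (cs ∷ʳ x) ≡ 0ℚ
  minor-∈-∷ʳ n r {x} x∈cs with ∈-∃++ x∈cs
  ... | as , bs , refl = trans (cong (minor n r) (++-assoc as (x ∷ bs) [ x ])) (minor-repeated n r as x bs [])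

  module _ (w : ℚ) {x y z : Column} (z≡wx-y : ∀ i → z i ≡ w * x i - y i) where

    -- The form w x - y is the recursion step of `altSum`, so a combination can be peeled off one
    -- column at a time. The induction is organised as for `minor-swap`.
    minor-linear : ∀ n r as bs →
      minor n r (as ++ z ∷ bs) ≡ w * minor n r (as ++ x ∷ bs) - minor n r (as ++ y ∷ bs)
    expand-linearˡ : ∀ n r as bs cs →
      expand n r (as ++ z ∷ bs) cs ≡ w * expand n r (as ++ x ∷ bs) cs - expand n r (as ++ y ∷ bs) cs
    expand-linearʳ : ∀ n r ps as bs →
      expand n r ps (as ++ z ∷ bs) ≡ w * expand n r ps (as ++ x ∷ bs) - expand n r ps (as ++ y ∷ bs)

    minor-linear zero    r []       bs = solve 1 (λ w → con 0ℚ := w :* con 0ℚ :- con 0ℚ) refl w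
    minor-linear zero    r (_ ∷ _)  bs = solve 1 (λ w → con 0ℚ := w :* con 0ℚ :- con 0ℚ) refl w
    minor-linear (suc n) r as       bs = expand-linearʳ n r [] as bs

    expand-linearˡ n r as bs []       = solve 1 (λ w → con 0ℚ := w :* con 0ℚ :- con 0ℚ) refl w
    expand-linearˡ n r as bs (c ∷ cs)
      rewrite ++-assoc as (x ∷ bs) cs | ++-assoc as (y ∷ bs) cs | ++-assoc as (z ∷ bs) cs
            | ++-assoc as (x ∷ bs) [ c ] | ++-assoc as (y ∷ bs) [ c ] | ++-assoc as (z ∷ bs) [ c ]
            | minor-linear n (suc r) as (bs ++ cs) | expand-linearˡ n r as (bs ∷ʳ c) cs
      = solve 6 (λ w c m m′ e e′ → c :* (w :* m :- m′) :- (w :* e :- e′)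
                   := w :* (c :* m :- e) :- (c :* m′ :- e′)) refl w (c r) _ _ _ _

    expand-linearʳ n r ps [] bs
      rewrite expand-linearˡ n r ps [] bs | z≡wx-y r
      = solve 6 (λ w x y m e e′ → (w :* x :- y) :* m :- (w :* e :- e′)
                   := w :* (x :* m :- e) :- (y :* m :- e′)) refl w (x r) (y r) _ _ _
    expand-linearʳ n r ps (a ∷ as) bs
      rewrite sym (++-assoc ps as (x ∷ bs)) | sym (++-assoc ps as (y ∷ bs)) | sym (++-assoc ps as (z ∷ bs))
            | minor-linear n (suc r) (ps ++ as) bs | expand-linearʳ n r (ps ∷ʳ a) as bs
      = solve 6 (λ w c m m′ e e′ → c :* (w :* m :- m′) :- (w :* e :- e′)
                   := w :* (c :* m :- e) :- (c :* m′ :- e′)) refl w (a r) _ _ _ _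

  expand-zero : ∀ r p ps cs → expand 0 r (p ∷ ps) cs ≡ 0ℚ
  expand-zero r p ps []       = refl
  expand-zero r p ps (c ∷ cs) rewrite expand-zero r p (ps ∷ʳ c) cs =
    solve 1 (λ c → c :* con 0ℚ :- con 0ℚ := con 0ℚ) refl (c r)

  -- In all rows but the bottom one the term picking `z` is zero, so `z` stays last until the bottom
  -- row, where it is the lower right corner and has sign +.
  minor-lastColumn : ∀ n r cs (z : Column) → (∀ i → i ℕ.< n → z (i ℕ.+ r) ≡ 0ℚ) →
    minor (suc n) r (cs ∷ʳ z) ≡ z (n ℕ.+ r) * minor n r cs
  expand-lastColumn : ∀ n r ps cs (z : Column) → (∀ i → i ℕ.< suc n → z (i ℕ.+ r) ≡ 0ℚ) →
    expand (suc n) r ps (cs ∷ʳ z) ≡ z (suc n ℕ.+ r) * expand n r ps cs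

  minor-lastColumn zero    r []       z z≡0 =
    solve 1 (λ z → z :* con 1ℚ :- con 0ℚ := z :* con 1ℚ) refl (z r)
  -- One row but at least two columns: both sides are 0 by the convention of `minor`.
  minor-lastColumn zero    r (c ∷ cs) z z≡0 = begin
    c r * minor 0 (suc r) (cs ∷ʳ z) - expand 0 r [ c ] (cs ∷ʳ z)
      ≡⟨ cong₂ (λ m e → c r * m - e) (nonempty cs) (expand-zero r c [] (cs ∷ʳ z)) ⟩
    c r * 0ℚ - 0ℚ
      ≡⟨ solve 2 (λ c z → c :* con 0ℚ :- con 0ℚ := z :* con 0ℚ) refl (c r) (z r) ⟩
    z r * 0ℚ ∎
    where
    nonempty : ∀ cs → minor 0 (suc r) (cs ∷ʳ z) ≡ 0ℚ
    nonempty []      = refl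
    nonempty (_ ∷ _) = refl
  minor-lastColumn (suc n) r cs       z z≡0 = expand-lastColumn n r [] cs z z≡0

  expand-lastColumn n r ps []       z z≡0
    rewrite z≡0 0 ℕ.z<s
    = solve 2 (λ m z → con 0ℚ :* m :- con 0ℚ := z :* con 0ℚ) refl (minor (suc n) (suc r) (ps ++ [])) (z (suc n ℕ.+ r))
  expand-lastColumn n r ps (c ∷ cs) z z≡0
    rewrite sym (++-assoc ps cs [ z ])
          | minor-lastColumn n (suc r) (ps ++ cs) z
              (λ i i<n → trans (cong z (ℕ.+-suc i r)) (z≡0 (suc i) (ℕ.s<s i<n)))
          | expand-lastColumn n r (ps ∷ʳ c) cs z z≡0
          | ℕ.+-suc n r
    = solve 4 (λ c z m e → c :* (z :* m) :- z :* e := z :* (c :* m :- e)) refl (c r) (z (suc n ℕ.+ r)) _ _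

  module _ (c : ℕ → Column) (w : ℕ → ℚ) where

    combination : ℕ → Column
    combination m i = altSum m λ j → w j * c j i

    -- By linearity every term has a column that already occurs in `cs`.
    minor-combination : ∀ n r m {cs} → (∀ {j} → j ℕ.≤ m → c j ∈ cs) →
      minor n r (cs ∷ʳ combination m) ≡ 0ℚ
    minor-combination n r zero {cs} c∈cs = begin
      minor n r (cs ∷ʳ combination 0)
        -- A single multiple w x is brought to the form of `minor-linear` as (w + 1) x - x.
        ≡⟨ minor-linear (w 0 + 1ℚ)
             (λ i → solve 2 (λ w x → w :* x := (w :+ con 1ℚ) :* x :- x) refl (w 0) (c 0 i)) n r cs [] ⟩
      (w 0 + 1ℚ) * minor n r (cs ∷ʳ c 0) - minor n r (cs ∷ʳ c 0)
        ≡⟨ cong (λ m → (w 0 + 1ℚ) * m - m) (minor-∈-∷ʳ n r (c∈cs ℕ.z≤n)) ⟩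
      (w 0 + 1ℚ) * 0ℚ - 0ℚ
        ≡⟨ solve 1 (λ w → (w :+ con 1ℚ) :* con 0ℚ :- con 0ℚ := con 0ℚ) refl (w 0) ⟩
      0ℚ ∎
    minor-combination n r (suc m) {cs} c∈cs = begin
      minor n r (cs ∷ʳ combination (suc m))
        ≡⟨ minor-linear (w (suc m)) (λ _ → refl) n r cs [] ⟩
      w (suc m) * minor n r (cs ∷ʳ c (suc m)) - minor n r (cs ∷ʳ combination m)
        ≡⟨ cong₂ (λ m₁ m₂ → w (suc m) * m₁ - m₂)
             (minor-∈-∷ʳ n r (c∈cs ℕ.≤-refl)) (minor-combination n r m (c∈cs ∘ ℕ.m≤n⇒m≤1+n)) ⟩
      w (suc m) * 0ℚ - 0ℚ
        ≡⟨ solve 1 (λ w → w :* con 0ℚ :- con 0ℚ := con 0ℚ) refl (w (suc m)) ⟩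
      0ℚ ∎

    -- Only the top term of the combination survives, since its other columns are already present.
    minor-replaceLast : ∀ n r m →
      minor (suc n) r (applyUpTo c m ∷ʳ combination m) ≡ w m * minor (suc n) r (applyUpTo c m ∷ʳ c m)
    minor-replaceLast n r zero =
      solve 3 (λ w x m → w :* x :* m :- con 0ℚ := w :* (x :* m :- con 0ℚ)) refl (w 0) (c 0 r) (minor n (suc r) [])
    minor-replaceLast n-1 r (suc m) = let n = suc n-1 in begin
      minor n r (cs ∷ʳ combination (suc m))
        ≡⟨ minor-linear (w (suc m)) (λ _ → refl) n r cs [] ⟩
      w (suc m) * minor n r (cs ∷ʳ c (suc m)) - minor n r (cs ∷ʳ combination m)
        ≡⟨ cong (λ m₂ → w (suc m) * minor n r (cs ∷ʳ c (suc m)) - m₂)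
             (minor-combination n r m (λ j≤m → ∈-applyUpTo⁺ c (ℕ.s≤s j≤m))) ⟩
      w (suc m) * minor n r (cs ∷ʳ c (suc m)) - 0ℚ
        ≡⟨ ℚ.+-identityʳ _ ⟩
      w (suc m) * minor n r (cs ∷ʳ c (suc m)) ∎
      where
      cs : List Column
      cs = applyUpTo c (suc m)

    -- The determinant whose last column is the combination is evaluated twice: linearity gives the
    -- left side, expansion at the only entry that may be nonzero gives the right side.
    cramer : ∀ n → (∀ i → i ℕ.< n → combination n i ≡ 0ℚ) →
      w n * minor (suc n) 0 (applyUpTo c (suc n)) ≡ combination n n * minor n 0 (applyUpTo c n)
    cramer n z≡0 = begin
      w n * minor (suc n) 0 (applyUpTo c (suc n))
        ≡⟨ cong (λ cs → w n * minor (suc n) 0 cs) (applyUpTo-∷ʳ c n) ⟨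
      w n * minor (suc n) 0 (applyUpTo c n ∷ʳ c n)
        ≡⟨ minor-replaceLast n 0 n ⟨
      minor (suc n) 0 (applyUpTo c n ∷ʳ combination n)
        ≡⟨ minor-lastColumn n 0 (applyUpTo c n) (combination n)
             (λ i i<n → trans (cong (combination n) (ℕ.+-identityʳ i)) (z≡0 i i<n)) ⟩
      combination n (n ℕ.+ 0) * minor n 0 (applyUpTo c n)
        ≡⟨ cong (λ i → combination n i * minor n 0 (applyUpTo c n)) (ℕ.+-identityʳ n) ⟩
      combination n n * minor n 0 (applyUpTo c n) ∎

-- Natural numbers and binomial coefficients inside the rationals.

module Binomials where
  open import Data.Rational.Base using (_+_; _*_; _-_)

  fromℚᵘ-homo-+ : ∀ p q → fromℚᵘ (p ℚᵘ.+ q) ≡ fromℚᵘ p + fromℚᵘ q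
  fromℚᵘ-homo-+ p q = ℚ.toℚᵘ-injective (ℚᵘ.≃-trans (ℚ.toℚᵘ-fromℚᵘ (p ℚᵘ.+ q)) (ℚᵘ.≃-sym
    (ℚᵘ.≃-trans (ℚ.toℚᵘ-homo-+ (fromℚᵘ p) (fromℚᵘ q)) (ℚᵘ.+-cong (ℚ.toℚᵘ-fromℚᵘ p) (ℚ.toℚᵘ-fromℚᵘ q)))))

  fromℚᵘ-homo-* : ∀ p q → fromℚᵘ (p ℚᵘ.* q) ≡ fromℚᵘ p * fromℚᵘ q
  fromℚᵘ-homo-* p q = ℚ.toℚᵘ-injective (ℚᵘ.≃-trans (ℚ.toℚᵘ-fromℚᵘ (p ℚᵘ.* q)) (ℚᵘ.≃-sym
    (ℚᵘ.≃-trans (ℚ.toℚᵘ-homo-* (fromℚᵘ p) (fromℚᵘ q)) (ℚᵘ.*-cong (ℚ.toℚᵘ-fromℚᵘ p) (ℚ.toℚᵘ-fromℚᵘ q)))))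

  fromℕ-+ : ∀ m n → fromℕ (m ℕ.+ n) ≡ fromℕ m + fromℕ n
  fromℕ-+ m n = trans
    (cong (λ i → i ℚ./ 1) (sym (cong₂ ℤ._+_ (ℤ.*-identityʳ (ℤ.+ m)) (ℤ.*-identityʳ (ℤ.+ n)))))
    (fromℚᵘ-homo-+ (mkℚᵘ (ℤ.+ m) 0) (mkℚᵘ (ℤ.+ n) 0))

  fromℕ-* : ∀ m n → fromℕ (m ℕ.* n) ≡ fromℕ m * fromℕ n
  fromℕ-* m n = trans (cong (λ i → i ℚ./ 1) (ℤ.pos-* m n)) (fromℚᵘ-homo-* (mkℚᵘ (ℤ.+ m) 0) (mkℚᵘ (ℤ.+ n) 0))

  fromℕ-suc : ∀ n → fromℕ (suc n) ≡ 1ℚ + fromℕ n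
  fromℕ-suc = fromℕ-+ 1

  /-*-fromℕ : ∀ m d → (ℤ.+ m ℚ./ suc d) * fromℕ (suc d) ≡ fromℕ m
  /-*-fromℕ m d = trans (sym (fromℚᵘ-homo-* (mkℚᵘ (ℤ.+ m) d) (mkℚᵘ (ℤ.+ suc d) 0)))
    (ℚ.fromℚᵘ-cong {mkℚᵘ (ℤ.+ m) d ℚᵘ.* mkℚᵘ (ℤ.+ suc d) 0} {mkℚᵘ (ℤ.+ m) 0}
      (*≡* (trans (ℤ.*-identityʳ _) (cong (λ e → ℤ.+ m ℤ.* ℤ.+ e) (sym (ℕ.*-identityʳ (suc d)))))))

  *-cancelʳ-fromℕ : ∀ {p q} n .{{_ : ℕ.NonZero n}} → p * fromℕ n ≡ q * fromℕ n → p ≡ q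
  *-cancelʳ-fromℕ n pn≡qn = ℚ.≤-antisym
    (ℚ.*-cancelʳ-≤-pos (fromℕ n) (ℚ.≤-reflexive pn≡qn))
    (ℚ.*-cancelʳ-≤-pos (fromℕ n) (ℚ.≤-reflexive (sym pn≡qn)))
    where
    instance
      positive : ℚ.Positive (fromℕ n)
      positive = ℚ.normalize-pos n 1

  binom : ℕ → ℕ → ℚ
  binom n k = fromℕ (n C k)

  pascal : ∀ n k → binom (suc n) (suc k) ≡ binom n k + binom n (suc k)
  pascal n k = trans (cong fromℕ (sym (nCk+nC[k+1]≡[n+1]C[k+1] n k))) (fromℕ-+ (n C k) (n C suc k))

  binom-< : ∀ {n k} → n ℕ.< k → binom n k ≡ 0ℚ
  binom-< n<k = cong fromℕ (k>n⇒nCk≡0 n<k)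

  -- Induction by Pascal's rule. This identity clears the denominator of `catalan` and yields the
  -- zeros of `ballot`.
  absorption : ∀ n k → fromℕ (suc k) * binom (suc n) (suc k) ≡ fromℕ (suc n) * binom n k
  absorption zero    zero    = refl
  absorption zero    (suc k) = trans
    (cong (fromℕ (suc (suc k)) *_) (binom-< {1} {suc (suc k)} (ℕ.s<s ℕ.z<s)))
    (trans (ℚ.*-zeroʳ (fromℕ (suc (suc k)))) (sym (cong (1ℚ *_) (binom-< {0} {suc k} ℕ.z<s))))
  absorption (suc n) zero    = begin
    1ℚ * binom (suc (suc n)) 1     ≡⟨ cong (λ m → 1ℚ * fromℕ m) (nC1≡n (suc (suc n))) ⟩
    1ℚ * fromℕ (suc (suc n))       ≡⟨ ℚ.*-comm 1ℚ (fromℕ (suc (suc n))) ⟩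
    fromℕ (suc (suc n)) * 1ℚ       ∎
  absorption (suc n) (suc k) = begin
    fromℕ (suc (suc k)) * binom (suc (suc n)) (suc (suc k))
      ≡⟨ cong₂ _*_ (fromℕ-suc (suc k)) (pascal (suc n) (suc k)) ⟩
    (1ℚ + K) * (X + Y)
      ≡⟨ solve 3 (λ K X Y → (con 1ℚ :+ K) :* (X :+ Y) := X :+ K :* X :+ (con 1ℚ :+ K) :* Y) refl K X Y ⟩
    X + K * X + (1ℚ + K) * Y
      ≡⟨ cong₂ (λ s t → X + s + t) (absorption n k)
           (trans (cong (_* Y) (sym (fromℕ-suc (suc k)))) (absorption n (suc k))) ⟩
    X + N * binom n k + N * binom n (suc k)
      ≡⟨ solve 4 (λ X N a b → X :+ N :* a :+ N :* b := X :+ N :* (a :+ b)) refl X N (binom n k) (binom n (suc k)) ⟩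
    X + N * (binom n k + binom n (suc k))
      ≡⟨ cong (λ s → X + N * s) (pascal n k) ⟨
    X + N * X
      ≡⟨ solve 2 (λ X N → X :+ N :* X := (con 1ℚ :+ N) :* X) refl X N ⟩
    (1ℚ + N) * X
      ≡⟨ cong (_* X) (fromℕ-suc (suc n)) ⟨
    fromℕ (suc (suc n)) * X ∎
    where
    K N X Y : ℚ
    K = fromℕ (suc k)
    N = fromℕ (suc n)
    X = binom (suc n) (suc k)
    Y = binom (suc n) (suc (suc k))

  fromℕ-∸ : ∀ {m n} → n ℕ.≤ m → fromℕ (m ℕ.∸ n) ≡ fromℕ m - fromℕ n
  fromℕ-∸ {m} {n} n≤m = begin
    fromℕ (m ℕ.∸ n)                       ≡⟨ solve 2 (λ x y → x := x :+ y :- y) refl (fromℕ (m ℕ.∸ n)) (fromℕ n) ⟩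
    fromℕ (m ℕ.∸ n) + fromℕ n - fromℕ n   ≡⟨ cong (_- fromℕ n) (fromℕ-+ (m ℕ.∸ n) n) ⟨
    fromℕ (m ℕ.∸ n ℕ.+ n) - fromℕ n       ≡⟨ cong (λ l → fromℕ l - fromℕ n) (ℕ.m∸n+n≡m n≤m) ⟩
    fromℕ m - fromℕ n                     ∎

  binom-sym : ∀ m n → binom (m ℕ.+ n) m ≡ binom (m ℕ.+ n) n
  binom-sym m n = cong fromℕ (trans (nCk≡nC[n∸k] (ℕ.m≤m+n m n)) (cong ((m ℕ.+ n) C_) (ℕ.m+n∸m≡n m n)))

  -- `∑≤` unfolds at its first term, whereas the partial sums used later grow at the last.
  ∑≤-suc : ∀ n f → ∑≤ (suc n) f ≡ ∑≤ n f ℕ.+ f (suc n)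
  ∑≤-suc zero    f = trans (cong (f 0 ℕ.+_) (ℕ.+-identityʳ (f 1))) (cong (ℕ._+ f 1) (sym (ℕ.+-identityʳ (f 0))))
  ∑≤-suc (suc n) f = trans (cong (f 0 ℕ.+_) (∑≤-suc n (λ s → f (suc s)))) (sym (ℕ.+-assoc (f 0) _ _))

-- Ballot numbers and generalised Catalan numbers.

module CatalanSums (k-2 : ℕ) where
  open AlternatingSums
  open Binomials
  open Minors
  open import Data.Rational.Base using (_+_; _*_; _-_; -_)

  r : ℕ
  r = suc k-2

  -- For r y ≤ x + 1, the number of lattice paths from (0,0) to (x,y) which stay in
  -- r y ≤ x; the formula has no such meaning further out.
  ballot : ℕ → ℕ → ℚ
  ballot x zero    = 1ℚ
  ballot x (suc y) = binom (x ℕ.+ suc y) (suc y) - fromℕ r * binom (x ℕ.+ suc y) y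

  -- A path ends with a step from the left or from below; algebraically this is Pascal's rule in
  -- both binomials.
  ballot-step : ∀ x y → ballot (suc x) (suc y) ≡ ballot x (suc y) + ballot (suc x) y
  ballot-step x zero = begin
    binom (suc (x ℕ.+ 1)) 1 - fromℕ r * 1ℚ             ≡⟨ cong (_- fromℕ r * 1ℚ) (pascal (x ℕ.+ 1) 0) ⟩
    1ℚ + binom (x ℕ.+ 1) 1 - fromℕ r * 1ℚ              ≡⟨ solve 2 (λ b R → con 1ℚ :+ b :- R :* con 1ℚ
                                                            := b :- R :* con 1ℚ :+ con 1ℚ) refl (binom (x ℕ.+ 1) 1) (fromℕ r) ⟩
    binom (x ℕ.+ 1) 1 - fromℕ r * 1ℚ + 1ℚ              ∎
  ballot-step x (suc y) = begin
    binom (suc n) (suc (suc y)) - R * binom (suc n) (suc y)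
      ≡⟨ cong₂ (λ s t → s - R * t) (pascal n (suc y)) (pascal n y) ⟩
    b₁ + b₂ - R * (b₀ + b₁)
      ≡⟨ solve 4 (λ b₀ b₁ b₂ R → b₁ :+ b₂ :- R :* (b₀ :+ b₁) := b₂ :- R :* b₁ :+ (b₁ :- R :* b₀)) refl b₀ b₁ b₂ R ⟩
    b₂ - R * b₁ + (b₁ - R * b₀)
      ≡⟨ cong (λ l → b₂ - R * b₁ + (binom l (suc y) - R * binom l y)) (ℕ.+-suc x (suc y)) ⟩
    b₂ - R * b₁ + (binom (suc x ℕ.+ suc y) (suc y) - R * binom (suc x ℕ.+ suc y) y) ∎
    where
    n : ℕ
    n = x ℕ.+ suc (suc y)
    R b₀ b₁ b₂ : ℚ
    R  = fromℕ r
    b₀ = binom n y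
    b₁ = binom n (suc y)
    b₂ = binom n (suc (suc y))

  -- The point (x, y+1) is one unit outside the allowed region. After multiplication by y+1,
  -- absorption turns the claim into an equality of two multiples of `binom n y`.
  ballot-boundary : ∀ x y → suc x ≡ suc y ℕ.* r → ballot x (suc y) ≡ 0ℚ
  ballot-boundary x y x+1≡[y+1]r = *-cancelʳ-fromℕ (suc y) (begin
    (b₁ - R * b₀) * Y
      ≡⟨ solve 4 (λ b₀ b₁ R Y → (b₁ :- R :* b₀) :* Y := Y :* (b₀ :+ b₁) :- (Y :* R :+ Y) :* b₀) refl b₀ b₁ R Y ⟩
    Y * (b₀ + b₁) - (Y * R + Y) * b₀
      ≡⟨ cong (λ s → Y * s - (Y * R + Y) * b₀) (pascal n y) ⟨
    Y * binom (suc n) (suc y) - (Y * R + Y) * b₀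
      ≡⟨ cong (_- (Y * R + Y) * b₀) (absorption n y) ⟩
    fromℕ (suc x ℕ.+ suc y) * b₀ - (Y * R + Y) * b₀
      ≡⟨ cong (λ s → s * b₀ - (Y * R + Y) * b₀) (fromℕ-+ (suc x) (suc y)) ⟩
    (fromℕ (suc x) + Y) * b₀ - (Y * R + Y) * b₀
      ≡⟨ cong (λ s → (s + Y) * b₀ - (Y * R + Y) * b₀) (trans (cong fromℕ x+1≡[y+1]r) (fromℕ-* (suc y) r)) ⟩
    (Y * R + Y) * b₀ - (Y * R + Y) * b₀
      ≡⟨ solve 2 (λ s Y → s :- s := con 0ℚ :* Y) refl ((Y * R + Y) * b₀) Y ⟩
    0ℚ * Y ∎)
    where
    n : ℕ
    n = x ℕ.+ suc y
    R Y b₀ b₁ : ℚ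
    R  = fromℕ r
    Y  = fromℕ (suc y)
    b₀ = binom n y
    b₁ = binom n (suc y)

  -- Clearing the denominator m + y + 1 leaves the identity `scaled`, which follows from absorption
  -- and Pascal's rule. The hypothesis makes the truncated subtraction exact.
  quotient≡ballot : ∀ m y → r ℕ.* y ℕ.≤ m →
    (ℤ.+ (m ℕ.∸ r ℕ.* y ℕ.+ 1) ℚ./ suc (m ℕ.+ y)) * fromℕ ((m ℕ.+ y ℕ.+ 1) C (m ℕ.+ 1)) ≡ ballot m y
  quotient≡ballot m y ry≤m = *-cancelʳ-fromℕ (suc (m ℕ.+ y)) (begin
    (ℤ.+ (m ℕ.∸ r ℕ.* y ℕ.+ 1) ℚ./ suc (m ℕ.+ y)) * B * N
      ≡⟨ solve 3 (λ x y z → x :* y :* z := x :* z :* y) refl (ℤ.+ (m ℕ.∸ r ℕ.* y ℕ.+ 1) ℚ./ suc (m ℕ.+ y)) B N ⟩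
    (ℤ.+ (m ℕ.∸ r ℕ.* y ℕ.+ 1) ℚ./ suc (m ℕ.+ y)) * N * B
      ≡⟨ cong (_* B) (/-*-fromℕ (m ℕ.∸ r ℕ.* y ℕ.+ 1) (m ℕ.+ y)) ⟩
    fromℕ (m ℕ.∸ r ℕ.* y ℕ.+ 1) * B
      ≡⟨ cong₂ _*_ numerator (cong fromℕ (cong₂ _C_ (ℕ.+-comm (m ℕ.+ y) 1) (ℕ.+-comm m 1))) ⟩
    (fromℕ m - fromℕ r * fromℕ y + 1ℚ) * binom (suc m ℕ.+ y) (suc m)
      ≡⟨ cong ((fromℕ m - fromℕ r * fromℕ y + 1ℚ) *_) (binom-sym (suc m) y) ⟩
    (fromℕ m - fromℕ r * fromℕ y + 1ℚ) * binom (suc m ℕ.+ y) y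
      ≡⟨ scaled y ⟩
    ballot m y * N ∎)
    where
    B N : ℚ
    B = fromℕ ((m ℕ.+ y ℕ.+ 1) C (m ℕ.+ 1))
    N = fromℕ (suc (m ℕ.+ y))

    numerator : fromℕ (m ℕ.∸ r ℕ.* y ℕ.+ 1) ≡ fromℕ m - fromℕ r * fromℕ y + 1ℚ
    numerator = begin
      fromℕ (m ℕ.∸ r ℕ.* y ℕ.+ 1)          ≡⟨ fromℕ-+ (m ℕ.∸ r ℕ.* y) 1 ⟩
      fromℕ (m ℕ.∸ r ℕ.* y) + 1ℚ           ≡⟨ cong (_+ 1ℚ) (fromℕ-∸ ry≤m) ⟩
      fromℕ m - fromℕ (r ℕ.* y) + 1ℚ       ≡⟨ cong (λ s → fromℕ m - s + 1ℚ) (fromℕ-* r y) ⟩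
      fromℕ m - fromℕ r * fromℕ y + 1ℚ     ∎

    scaled : ∀ y → (fromℕ m - fromℕ r * fromℕ y + 1ℚ) * binom (suc m ℕ.+ y) y ≡ ballot m y * fromℕ (suc (m ℕ.+ y))
    scaled zero = begin
      (fromℕ m - fromℕ r * 0ℚ + 1ℚ) * 1ℚ   ≡⟨ solve 2 (λ m r → (m :- r :* con 0ℚ :+ con 1ℚ) :* con 1ℚ
                                                := con 1ℚ :* (con 1ℚ :+ m)) refl (fromℕ m) (fromℕ r) ⟩
      1ℚ * (1ℚ + fromℕ m)                  ≡⟨ cong (1ℚ *_) (fromℕ-suc m) ⟨
      1ℚ * fromℕ (suc m)                   ≡⟨ cong (λ l → 1ℚ * fromℕ (suc l)) (ℕ.+-identityʳ m) ⟨
      1ℚ * fromℕ (suc (m ℕ.+ 0))           ∎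
    scaled (suc y) = begin
      (M - R * Y + 1ℚ) * A
        ≡⟨ solve 4 (λ M R Y A → (M :- R :* Y :+ con 1ℚ) :* A
             := A :* (con 1ℚ :+ (M :+ Y)) :- (con 1ℚ :+ R) :* (Y :* A)) refl M R Y A ⟩
      A * (1ℚ + (M + Y)) - (1ℚ + R) * (Y * A)
        ≡⟨ cong₂ (λ s t → A * s - (1ℚ + R) * t)
             (sym (trans (fromℕ-suc n) (cong (λ s → 1ℚ + s) (fromℕ-+ m (suc y))))) (absorption n y) ⟩
      A * fromℕ (suc n) - (1ℚ + R) * (fromℕ (suc n) * b₀)
        ≡⟨ cong (λ s → s * fromℕ (suc n) - (1ℚ + R) * (fromℕ (suc n) * b₀)) (pascal n y) ⟩
      (b₀ + b₁) * fromℕ (suc n) - (1ℚ + R) * (fromℕ (suc n) * b₀)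
        ≡⟨ solve 4 (λ b₀ b₁ R N → (b₀ :+ b₁) :* N :- (con 1ℚ :+ R) :* (N :* b₀)
             := (b₁ :- R :* b₀) :* N) refl b₀ b₁ R (fromℕ (suc n)) ⟩
      (b₁ - R * b₀) * fromℕ (suc n) ∎
      where
      n : ℕ
      n = m ℕ.+ suc y
      M R Y A b₀ b₁ : ℚ
      M  = fromℕ m
      R  = fromℕ r
      Y  = fromℕ (suc y)
      A  = binom (suc n) (suc y)
      b₀ = binom n y
      b₁ = binom n (suc y)

  -- The Catalan series and the ballot recurrence.

  q : ℕ → ℕ
  q m = m / r

  cat : ℕ → ℚ
  cat m = catalan m (2+ k-2)

  cat≡ballot : ∀ m → cat m ≡ ballot m (q m)
  cat≡ballot m = quotient≡ballot m (q m) (ℕ.≤-trans (ℕ.≤-reflexive (ℕ.*-comm r (q m))) (m/n*n≤m m r))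

  -- The coefficient of u^N in ∑ cat X · u^X · (1 - u)^(φ X).
  coeff : (ℕ → ℕ) → ℕ → ℚ
  coeff φ N = altSum N λ X → binom (φ X) (N ℕ.∸ X) * cat X

  coeff-pascal : ∀ φ ψ N →
    (∀ X → X ℕ.≤ N → binom (φ X) (suc (N ℕ.∸ X)) ≡ binom (ψ X) (N ℕ.∸ X) + binom (ψ X) (suc (N ℕ.∸ X))) →
    coeff φ (suc N) ≡ coeff ψ (suc N) - coeff ψ N
  coeff-pascal φ ψ N split = begin
    binom (φ (suc N)) (N ℕ.∸ N) * c - altSum N (λ X → binom (φ X) (suc N ℕ.∸ X) * cat X)
      ≡⟨ cong₂ (λ s t → s * c - t) top (altSum-cong N term) ⟩
    binom (ψ (suc N)) (N ℕ.∸ N) * c - altSum N (λ X → 1ℚ * f X + 1ℚ * g X)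
      ≡⟨ cong (λ t → binom (ψ (suc N)) (N ℕ.∸ N) * c - t) (altSum-linear N 1ℚ 1ℚ f g) ⟩
    binom (ψ (suc N)) (N ℕ.∸ N) * c - (1ℚ * altSum N f + 1ℚ * altSum N g)
      ≡⟨ solve 3 (λ x s t → x :- (con 1ℚ :* s :+ con 1ℚ :* t) := x :- t :- s) refl
           (binom (ψ (suc N)) (N ℕ.∸ N) * c) (altSum N f) (altSum N g) ⟩
    binom (ψ (suc N)) (N ℕ.∸ N) * c - altSum N g - altSum N f ∎
    where
    c : ℚ
    c = cat (suc N)
    f g : ℕ → ℚ
    f X = binom (ψ X) (N ℕ.∸ X) * cat X
    g X = binom (ψ X) (suc N ℕ.∸ X) * cat X

    top : binom (φ (suc N)) (N ℕ.∸ N) ≡ binom (ψ (suc N)) (N ℕ.∸ N)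
    top = begin
      binom (φ (suc N)) (N ℕ.∸ N) ≡⟨ cong (binom (φ (suc N))) (ℕ.n∸n≡0 N) ⟩
      1ℚ                          ≡⟨ cong (binom (ψ (suc N))) (ℕ.n∸n≡0 N) ⟨
      binom (ψ (suc N)) (N ℕ.∸ N) ∎

    term : ∀ X → X ℕ.≤ N → binom (φ X) (suc N ℕ.∸ X) * cat X ≡ 1ℚ * f X + 1ℚ * g X
    term X X≤N = begin
      binom (φ X) (suc N ℕ.∸ X) * cat X
        ≡⟨ cong (λ l → binom (φ X) l * cat X) (ℕ.+-∸-assoc 1 X≤N) ⟩
      binom (φ X) (suc (N ℕ.∸ X)) * cat X
        ≡⟨ cong (_* cat X) (split X X≤N) ⟩
      (binom (ψ X) (N ℕ.∸ X) + binom (ψ X) (suc (N ℕ.∸ X))) * cat X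
        ≡⟨ cong (λ l → (binom (ψ X) (N ℕ.∸ X) + binom (ψ X) l) * cat X) (ℕ.+-∸-assoc 1 X≤N) ⟨
      (binom (ψ X) (N ℕ.∸ X) + binom (ψ X) (suc N ℕ.∸ X)) * cat X
        ≡⟨ solve 3 (λ a b c → (a :+ b) :* c := con 1ℚ :* (a :* c) :+ con 1ℚ :* (b :* c)) refl
             (binom (ψ X) (N ℕ.∸ X)) (binom (ψ X) (suc N ℕ.∸ X)) (cat X) ⟩
      1ℚ * f X + 1ℚ * g X ∎

  -- A term u^X (1-u)^0 contributes in degree X only, and for X = N the constant term of (1-u)^(φ N)
  -- is 1.
  coeff-top : ∀ φ N → (∀ X → X ℕ.< N → φ X ≡ 0) → coeff φ N ≡ cat N
  coeff-top φ N φ≡0 = begin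
    coeff φ N                        ≡⟨ altSum-last N vanish ⟩
    binom (φ N) (N ℕ.∸ N) * cat N    ≡⟨ cong (λ l → binom (φ N) l * cat N) (ℕ.n∸n≡0 N) ⟩
    1ℚ * cat N                       ≡⟨ ℚ.*-identityˡ (cat N) ⟩
    cat N                            ∎
    where
    vanish : ∀ X → X ℕ.< N → binom (φ X) (N ℕ.∸ X) * cat X ≡ 0ℚ
    vanish X X<N = trans
      (cong (_* cat X) (binom-< (subst (ℕ._< N ℕ.∸ X) (sym (φ≡0 X X<N)) (ℕ.m<n⇒0<n∸m X<N))))
      (ℚ.*-zeroˡ (cat X))

  q-mono : ∀ {m n} → m ℕ.≤ n → q m ℕ.≤ q n
  q-mono = /-monoˡ-≤ r

  m<[1+q]r : ∀ m → m ℕ.< suc (q m) ℕ.* r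
  m<[1+q]r m = ℕ.≤-trans (ℕ.≤-reflexive (cong suc (m≡m%n+[m/n]*n m r)))
    (ℕ.+-monoˡ-≤ (q m ℕ.* r) (m%n<n m r))

  -- The exponent of 1-u attached to C_X at height y: `residual 0` is `q`, and the exponent is 0 as
  -- soon as q X ≤ y.
  residual : ℕ → ℕ → ℕ
  residual y X = q X ℕ.∸ y

  coeff-on-boundary : ∀ x {y} → y ≡ q x → coeff (residual y) x ≡ ballot x y
  coeff-on-boundary x refl = trans
    (coeff-top (residual (q x)) x λ X X<x → ℕ.m≤n⇒m∸n≡0 (q-mono (ℕ.<⇒≤ X<x)))
    (cat≡ballot x)

  -- Here the boundary jumps from at most y to y+1, so the left neighbour (x, y+1) lies just outside
  -- it and has ballot number 0; the recurrence loses that term.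
  coeff-below-corner : ∀ x y → q x ℕ.≤ y → y ℕ.< q (suc x) → coeff (residual y) (suc x) ≡ ballot (suc x) y
  coeff-below-corner x y q≤y y<q = begin
    coeff (residual y) (suc x)
      ≡⟨ coeff-top (residual y) (suc x) (λ X X<1+x → ℕ.m≤n⇒m∸n≡0 (ℕ.≤-trans (q-mono (ℕ.s≤s⁻¹ X<1+x)) q≤y)) ⟩
    cat (suc x)                          ≡⟨ cat≡ballot (suc x) ⟩
    ballot (suc x) (q (suc x))           ≡⟨ cong (ballot (suc x)) q≡1+y ⟩
    ballot (suc x) (suc y)               ≡⟨ ballot-step x y ⟩
    ballot x (suc y) + ballot (suc x) y  ≡⟨ cong (_+ ballot (suc x) y) (ballot-boundary x y 1+x≡[1+y]r) ⟩
    0ℚ + ballot (suc x) y                ≡⟨ ℚ.+-identityˡ (ballot (suc x) y) ⟩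
    ballot (suc x) y                     ∎
    where
    -- Squeezed by x + 1 ≤ (q x + 1) r ≤ (y + 1) r ≤ q (x + 1) r ≤ x + 1.
    1+x≡[1+y]r : suc x ≡ suc y ℕ.* r
    1+x≡[1+y]r = ℕ.≤-antisym
      (ℕ.≤-trans (m<[1+q]r x) (ℕ.*-monoˡ-≤ r (ℕ.s≤s q≤y)))
      (ℕ.≤-trans (ℕ.*-monoˡ-≤ r y<q) (m/n*n≤m (suc x) r))

    q≡1+y : q (suc x) ≡ suc y
    q≡1+y = trans (cong q 1+x≡[1+y]r) (m*n/n≡m (suc y) r)

  residual-pascal : ∀ x y → y ℕ.< q x → ∀ X → X ℕ.≤ x →
    binom (residual y X) (suc (x ℕ.∸ X)) ≡
      binom (residual (suc y) X) (x ℕ.∸ X) + binom (residual (suc y) X) (suc (x ℕ.∸ X))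
  residual-pascal x y y<qx X X≤x = [ inside , outside ]′ (ℕ.<-≤-connex y (q X))
    where
    Split : Set
    Split = binom (residual y X) (suc (x ℕ.∸ X)) ≡
      binom (residual (suc y) X) (x ℕ.∸ X) + binom (residual (suc y) X) (suc (x ℕ.∸ X))

    inside : y ℕ.< q X → Split
    inside y<qX = trans
      (cong (λ l → binom l (suc (x ℕ.∸ X))) (ℕ.+-∸-assoc 1 y<qX))
      (pascal (residual (suc y) X) (x ℕ.∸ X))

    outside : q X ℕ.≤ y → Split
    outside qX≤y = begin
      binom (residual y X) (suc (x ℕ.∸ X))
        ≡⟨ cong (λ l → binom l (suc (x ℕ.∸ X))) (ℕ.m≤n⇒m∸n≡0 qX≤y) ⟩
      binom 0 (suc (x ℕ.∸ X))
        ≡⟨ ℚ.+-identityˡ (binom 0 (suc (x ℕ.∸ X))) ⟨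
      0ℚ + binom 0 (suc (x ℕ.∸ X))
        ≡⟨ cong (_+ binom 0 (suc (x ℕ.∸ X))) (binom-< (ℕ.m<n⇒0<n∸m X<x)) ⟨
      binom 0 (x ℕ.∸ X) + binom 0 (suc (x ℕ.∸ X))
        ≡⟨ cong (λ l → binom l (x ℕ.∸ X) + binom l (suc (x ℕ.∸ X))) (ℕ.m≤n⇒m∸n≡0 (ℕ.m≤n⇒m≤1+n qX≤y)) ⟨
      binom (residual (suc y) X) (x ℕ.∸ X) + binom (residual (suc y) X) (suc (x ℕ.∸ X)) ∎
      where
      X<x : X ℕ.< x
      -- X = x would contradict q X ≤ y < q x; so the lower index x - X is positive and
      -- `binom 0 (x ℕ.∸ X)` is 0 rather than 1.
      X<x = ℕ.≤∧≢⇒< X≤x λ { refl → ℕ.<⇒≱ y<qx qX≤y }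

  coeff-interior : ∀ x y → y ℕ.< q x →
    coeff (residual (suc y)) (suc x) ≡ ballot (suc x) (suc y) →
    coeff (residual (suc y)) x ≡ ballot x (suc y) →
    coeff (residual y) (suc x) ≡ ballot (suc x) y
  coeff-interior x y y<qx ih₁ ih₂ = begin
    coeff (residual y) (suc x)
      ≡⟨ coeff-pascal (residual y) (residual (suc y)) x (residual-pascal x y y<qx) ⟩
    coeff (residual (suc y)) (suc x) - coeff (residual (suc y)) x
      ≡⟨ cong₂ _-_ ih₁ ih₂ ⟩
    ballot (suc x) (suc y) - ballot x (suc y)
      ≡⟨ cong (_- ballot x (suc y)) (ballot-step x y) ⟩
    ballot x (suc y) + ballot (suc x) y - ballot x (suc y)
      ≡⟨ solve 2 (λ s t → s :+ t :- s := t) refl (ballot x (suc y)) (ballot (suc x) y) ⟩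
    ballot (suc x) y ∎

  -- Iterates ballot x y = ballot x (y+1) - ballot (x-1) (y+1) until the boundary
  -- y = q x is reached; the points just outside it have ballot number 0.
  coeff≡ballot : ∀ d x y → y ℕ.≤ q x → q x ℕ.≤ d ℕ.+ y → coeff (residual y) x ≡ ballot x y
  coeff≡ballot zero    x       y y≤q q≤y = coeff-on-boundary x (ℕ.≤-antisym y≤q q≤y)
  coeff≡ballot (suc d) zero    y y≤q q≤d+y = coeff-on-boundary 0 (ℕ.≤-antisym y≤q ℕ.z≤n)
  coeff≡ballot (suc d) (suc x) y y≤q q≤d+y =
    [ (λ y<q → [ interior y<q , (λ qx≤y → coeff-below-corner x y qx≤y y<q) ]′ (ℕ.<-≤-connex y (q x)))
    , coeff-on-boundary (suc x) ]′ (ℕ.m≤n⇒m<n∨m≡n y≤q)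
    where
    q≤d+1+y : q (suc x) ℕ.≤ d ℕ.+ suc y
    q≤d+1+y = ℕ.≤-trans q≤d+y (ℕ.≤-reflexive (sym (ℕ.+-suc d y)))

    interior : y ℕ.< q (suc x) → y ℕ.< q x → coeff (residual y) (suc x) ≡ ballot (suc x) y
    interior y<q y<qx = coeff-interior x y y<qx
      (coeff≡ballot d (suc x) (suc y) y<q q≤d+1+y)
      (coeff≡ballot d x (suc y) y<qx (ℕ.≤-trans (q-mono (ℕ.n≤1+n x)) q≤d+1+y))

  -- The coefficients of (1-u)^(d-1).

  shifted : ℕ → ℕ → ℚ
  shifted d N = coeff (λ X → q X ℕ.+ d) N

  -- The ballot number at (N, 0) is 1: the whole series is 1/(1-u).
  shifted-0 : ∀ N → shifted 0 N ≡ 1ℚ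
  shifted-0 N = trans
    (altSum-cong N λ X _ → cong (λ l → binom l (N ℕ.∸ X) * cat X) (ℕ.+-identityʳ (q X)))
    (coeff≡ballot (q N) N 0 ℕ.z≤n (ℕ.≤-reflexive (sym (ℕ.+-identityʳ (q N)))))

  shifted-pascal : ∀ d N → shifted (suc d) (suc N) ≡ shifted d (suc N) - shifted d N
  shifted-pascal d N = coeff-pascal _ _ N λ X _ → trans
    (cong (λ l → binom l (suc (N ℕ.∸ X))) (ℕ.+-suc (q X) d)) (pascal (q X ℕ.+ d) (N ℕ.∸ X))

  -- The series is now (1-u)^d, a polynomial of degree d.
  shifted-suc : ∀ d N → d ℕ.< N → shifted (suc d) N ≡ 0ℚ
  shifted-suc zero    (suc N) _ = trans (shifted-pascal 0 N)
    (cong₂ _-_ (shifted-0 (suc N)) (shifted-0 N))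
  shifted-suc (suc d) (suc N) d<N = trans (shifted-pascal (suc d) N)
    (cong₂ _-_ (shifted-suc d (suc N) (ℕ.m≤n⇒m≤1+n (ℕ.s≤s⁻¹ d<N))) (shifted-suc d N (ℕ.s≤s⁻¹ d<N)))

  -- Orthogonality of the weights to the rows of Catalan numbers.

  module _ (β : ℕ) (β≤r : β ℕ.≤ r) where

    weight : ℕ → ℕ → ℕ
    weight n s = (q (s ℕ.+ β) ℕ.+ n) C (n ℕ.∸ s)

    moment : ℕ → ℕ → ℚ
    moment n i = altSum n λ s → fromℕ (weight n s) * cat (r ℕ.* i ℕ.+ s ℕ.+ β)

    -- The terms of shifted with X < r i + β vanish, because q X ≤ i there; this uses β ≤ r.
    moment≡shifted : ∀ d i → moment (d ℕ.+ i) i ≡ shifted d (d ℕ.+ i ℕ.+ (r ℕ.* i ℕ.+ β))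
    moment≡shifted d i = sym (begin
      shifted d (n ℕ.+ m)
        ≡⟨ altSum-shift m n _ vanish ⟩
      altSum n (λ s → binom (q (s ℕ.+ m) ℕ.+ d) (n ℕ.+ m ℕ.∸ (s ℕ.+ m)) * cat (s ℕ.+ m))
        ≡⟨ altSum-cong n (λ s _ → cong₂ _*_ (cong₂ binom (top s) (bottom s)) (cong cat (index s))) ⟩
      moment n i ∎)
      where
      n m : ℕ
      n = d ℕ.+ i
      m = r ℕ.* i ℕ.+ β

      index : ∀ s → s ℕ.+ m ≡ r ℕ.* i ℕ.+ s ℕ.+ β
      index s = trans (sym (ℕ.+-assoc s (r ℕ.* i) β)) (cong (ℕ._+ β) (ℕ.+-comm s (r ℕ.* i)))

      q-shift : ∀ x → q (r ℕ.* i ℕ.+ x) ≡ i ℕ.+ q x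
      q-shift x = trans (+-distrib-/-∣ˡ x (m∣m*n i))
        (cong (ℕ._+ q x) (trans (cong q (ℕ.*-comm r i)) (m*n/n≡m i r)))

      top : ∀ s → q (s ℕ.+ m) ℕ.+ d ≡ q (s ℕ.+ β) ℕ.+ n
      top s = begin
        q (s ℕ.+ m) ℕ.+ d                  ≡⟨ cong (λ x → q x ℕ.+ d) (trans (index s) (ℕ.+-assoc (r ℕ.* i) s β)) ⟩
        q (r ℕ.* i ℕ.+ (s ℕ.+ β)) ℕ.+ d    ≡⟨ cong (ℕ._+ d) (q-shift (s ℕ.+ β)) ⟩
        i ℕ.+ q (s ℕ.+ β) ℕ.+ d            ≡⟨ cong (ℕ._+ d) (ℕ.+-comm i (q (s ℕ.+ β))) ⟩
        q (s ℕ.+ β) ℕ.+ i ℕ.+ d            ≡⟨ ℕ.+-assoc (q (s ℕ.+ β)) i d ⟩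
        q (s ℕ.+ β) ℕ.+ (i ℕ.+ d)          ≡⟨ cong (q (s ℕ.+ β) ℕ.+_) (ℕ.+-comm i d) ⟩
        q (s ℕ.+ β) ℕ.+ n                  ∎

      bottom : ∀ s → n ℕ.+ m ℕ.∸ (s ℕ.+ m) ≡ n ℕ.∸ s
      bottom s = trans (cong₂ ℕ._∸_ (ℕ.+-comm n m) (ℕ.+-comm s m)) (ℕ.[m+n]∸[m+o]≡n∸o m n s)

      q≤i : ∀ X → X ℕ.< m → q X ℕ.≤ i
      q≤i X X<m = ℕ.s≤s⁻¹ (m<n*o⇒m/o<n (ℕ.≤-trans X<m (ℕ.≤-trans
        (ℕ.+-monoʳ-≤ (r ℕ.* i) β≤r)
        (ℕ.≤-reflexive (trans (ℕ.+-comm (r ℕ.* i) r) (cong (r ℕ.+_) (ℕ.*-comm r i)))))))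

      vanish : ∀ X → X ℕ.< m → binom (q X ℕ.+ d) (n ℕ.+ m ℕ.∸ X) * cat X ≡ 0ℚ
      vanish X X<m = trans (cong (_* cat X) (binom-< bound)) (ℚ.*-zeroˡ (cat X))
        where
        bound : q X ℕ.+ d ℕ.< n ℕ.+ m ℕ.∸ X
        bound = ℕ.≤-trans
          (ℕ.s≤s (ℕ.≤-trans (ℕ.+-monoˡ-≤ d (q≤i X X<m)) (ℕ.≤-reflexive (ℕ.+-comm i d))))
          (ℕ.≤-trans (ℕ.≤-trans (ℕ.≤-reflexive (ℕ.+-comm 1 n)) (ℕ.+-monoʳ-≤ n (ℕ.m<n⇒0<n∸m X<m)))
            (ℕ.≤-reflexive (sym (ℕ.+-∸-assoc n (ℕ.<⇒≤ X<m)))))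

    moment-diagonal : ∀ n → moment n n ≡ 1ℚ
    moment-diagonal n = trans (moment≡shifted 0 n) (shifted-0 (n ℕ.+ (r ℕ.* n ℕ.+ β)))

    -- With n = d + 1 + i this is a coefficient of (1-u)^d in degree at least n, which exceeds d.
    moment-below : ∀ n i → i ℕ.< n → moment n i ≡ 0ℚ
    moment-below n i i<n = subst (λ n → moment n i ≡ 0ℚ)
      (trans (sym (ℕ.+-suc d i)) (ℕ.m∸n+n≡m i<n))
      (trans (moment≡shifted (suc d) i)
        (shifted-suc d (suc d ℕ.+ i ℕ.+ (r ℕ.* i ℕ.+ β))
          (ℕ.s≤s (ℕ.≤-trans (ℕ.m≤m+n d i) (ℕ.m≤m+n (d ℕ.+ i) (r ℕ.* i ℕ.+ β))))))
      where
      d : ℕ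
      d = n ℕ.∸ suc i

    -- Partial summation and the recurrence for the determinant.

    column : ℕ → Column
    column j i = cat (r ℕ.* i ℕ.+ j ℕ.+ β) + cat (r ℕ.* i ℕ.+ j ℕ.+ β ℕ.+ 1)

    partial : ℕ → ℕ → ℚ
    partial n j = fromℕ (∑≤ j (weight n))

    partial-suc : ∀ n j → partial n (suc j) ≡ partial n j + fromℕ (weight n (suc j))
    partial-suc n j = trans (cong fromℕ (∑≤-suc j (weight n))) (fromℕ-+ (∑≤ j (weight n)) (weight n (suc j)))

    total : ℕ → ℕ
    total n = ∑≤ n (weight n)

    weight-diagonal : ∀ n → weight n n ≡ 1
    weight-diagonal n = cong ((q (n ℕ.+ β) ℕ.+ n) C_) (ℕ.n∸n≡0 n)

    -- The last summand is 1. This permits cancelling S n in the recurrence.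
    total≢0 : ∀ n → ℕ.NonZero (total n)
    total≢0 zero    = _
    total≢0 (suc n) = subst ℕ.NonZero
      (sym (trans (∑≤-suc n (weight (suc n))) (trans
        (cong (∑≤ n (weight (suc n)) ℕ.+_) (weight-diagonal (suc n))) (ℕ.+-comm _ 1)))) _

    module _ (i : ℕ) where

      entry : ℕ → ℚ
      entry j = cat (r ℕ.* i ℕ.+ j ℕ.+ β)

      column≡ : ∀ j → column j i ≡ entry j + entry (suc j)
      column≡ j = cong (λ m → entry j + cat m) (trans
        (ℕ.+-comm (r ℕ.* i ℕ.+ j ℕ.+ β) 1) (cong (ℕ._+ β) (sym (ℕ.+-suc (r ℕ.* i) j))))

      -- Each inner entry appears in two neighbouring columns with opposite signs, so its
      -- coefficient is a difference of consecutive partial sums, that is, a weight.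
      abel : ∀ n j → altSum j (λ l → partial n l * column l i) ≡
        altSum j (λ l → fromℕ (weight n l) * entry l) + partial n j * entry (suc j)
      abel n zero    = begin
        partial n 0 * column 0 i
          ≡⟨ cong₂ _*_ (cong fromℕ (ℕ.+-identityʳ (weight n 0))) (column≡ 0) ⟩
        fromℕ (weight n 0) * (entry 0 + entry 1)
          ≡⟨ ℚ.*-distribˡ-+ (fromℕ (weight n 0)) (entry 0) (entry 1) ⟩
        fromℕ (weight n 0) * entry 0 + fromℕ (weight n 0) * entry 1
          ≡⟨ cong (λ m → fromℕ (weight n 0) * entry 0 + fromℕ m * entry 1) (ℕ.+-identityʳ (weight n 0)) ⟨
        fromℕ (weight n 0) * entry 0 + partial n 0 * entry 1 ∎
      abel n (suc j) = begin
        partial n (suc j) * column (suc j) i - altSum j (λ l → partial n l * column l i)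
          ≡⟨ cong₂ _-_ (cong₂ _*_ (partial-suc n j) (column≡ (suc j))) (abel n j) ⟩
        (P + W) * (x + y) - (A + P * x)
          ≡⟨ solve 5 (λ P W x y A → (P :+ W) :* (x :+ y) :- (A :+ P :* x) := W :* x :- A :+ (P :+ W) :* y) refl P W x y A ⟩
        W * x - A + (P + W) * y
          ≡⟨ cong (λ s → W * x - A + s * y) (partial-suc n j) ⟨
        W * x - A + partial n (suc j) * y ∎
        where
        P W x y A : ℚ
        P = partial n j
        W = fromℕ (weight n (suc j))
        x = entry (suc j)
        y = entry (suc (suc j))
        A = altSum j (λ l → fromℕ (weight n l) * entry l)

    -- Chosen so that the boundary terms of abel for n and n + 1 cancel.
    coefficient : ℕ → ℕ → ℚ
    coefficient n j = partial (suc n) (suc n) * partial n j + (- partial n n) * partial (suc n) j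

    -- S (n+1) exceeds the partial sum up to n by the last weight, which is 1.
    coefficient-last : ∀ n → coefficient n n ≡ fromℕ (total n)
    coefficient-last n = begin
      partial (suc n) (suc n) * S + (- S) * P
        ≡⟨ cong (λ t → t * S + (- S) * P) (partial-suc (suc n) n) ⟩
      (P + fromℕ (weight (suc n) (suc n))) * S + (- S) * P
        ≡⟨ cong (λ m → (P + fromℕ m) * S + (- S) * P) (weight-diagonal (suc n)) ⟩
      (P + 1ℚ) * S + (- S) * P
        ≡⟨ solve 2 (λ P S → (P :+ con 1ℚ) :* S :+ (:- S) :* P := S) refl P S ⟩
      S ∎
      where
      S P : ℚ
      S = partial n n
      P = partial (suc n) n

    combination≡moments : ∀ n i → combination column (coefficient n) n i ≡
      fromℕ (total (suc n)) * moment n i + fromℕ (total n) * moment (suc n) i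
    combination≡moments n i = begin
      altSum n (λ j → coefficient n j * column j i)
        ≡⟨ altSum-cong n (λ j _ → solve 5 (λ S S′ P P′ c → (S′ :* P :+ (:- S) :* P′) :* c
             := S′ :* (P :* c) :+ (:- S) :* (P′ :* c)) refl S S′ (partial n j) (partial (suc n) j) (column j i)) ⟩
      altSum n (λ j → S′ * (partial n j * column j i) + (- S) * (partial (suc n) j * column j i))
        ≡⟨ altSum-linear n S′ (- S) _ _ ⟩
      S′ * altSum n (λ j → partial n j * column j i) + (- S) * altSum n (λ j → partial (suc n) j * column j i)
        ≡⟨ cong₂ (λ s t → S′ * s + (- S) * t) (abel i n n) (abel i (suc n) n) ⟩
      S′ * (moment n i + S * x) + (- S) * (A + P * x)
        ≡⟨ cong (λ s → s * (moment n i + S * x) + (- S) * (A + P * x)) (partial-suc (suc n) n) ⟩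
      (P + W) * (moment n i + S * x) + (- S) * (A + P * x)
        -- What remains of the boundary terms is S W x, which supplies the top term of
        -- `moment (suc n) i`, by definition W x - A.
        ≡⟨ solve 6 (λ P W M S x A → (P :+ W) :* (M :+ S :* x) :+ (:- S) :* (A :+ P :* x)
             := (P :+ W) :* M :+ S :* (W :* x :- A)) refl P W (moment n i) S x A ⟩
      (P + W) * moment n i + S * moment (suc n) i
        ≡⟨ cong (λ s → s * moment n i + S * moment (suc n) i) (partial-suc (suc n) n) ⟨
      S′ * moment n i + S * moment (suc n) i ∎
      where
      S S′ P W x A : ℚ
      S  = fromℕ (total n)
      S′ = fromℕ (total (suc n))
      P  = partial (suc n) n
      W  = fromℕ (weight (suc n) (suc n))
      x  = entry i (suc n)
      A  = altSum n (λ j → fromℕ (weight (suc n) j) * entry i j)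

    -- Induction through `cramer`: the combination is 0 in rows below n and S (n+1) in row n, so the
    -- nonzero factor S n can be cancelled.
    minor≡total : ∀ n → minor n 0 (applyUpTo column n) ≡ fromℕ (total n)
    minor≡total zero    = refl
    minor≡total (suc n) = *-cancelʳ-fromℕ (total n) {{total≢0 n}} (begin
      D′ * S
        ≡⟨ ℚ.*-comm D′ S ⟩
      S * D′
        ≡⟨ cong (_* D′) (coefficient-last n) ⟨
      coefficient n n * D′
        ≡⟨ cramer column (coefficient n) n vanish ⟩
      combination column (coefficient n) n n * D
        ≡⟨ cong₂ _*_ diagonal (minor≡total n) ⟩
      S′ * S ∎)
      where
      S S′ D D′ : ℚ
      S  = fromℕ (total n)
      S′ = fromℕ (total (suc n))
      D  = minor n 0 (applyUpTo column n)
      D′ = minor (suc n) 0 (applyUpTo column (suc n))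

      vanish : ∀ i → i ℕ.< n → combination column (coefficient n) n i ≡ 0ℚ
      vanish i i<n = begin
        combination column (coefficient n) n i
          ≡⟨ combination≡moments n i ⟩
        S′ * moment n i + S * moment (suc n) i
          ≡⟨ cong₂ (λ s t → S′ * s + S * t) (moment-below n i i<n) (moment-below (suc n) i (ℕ.m<n⇒m<1+n i<n)) ⟩
        S′ * 0ℚ + S * 0ℚ
          ≡⟨ solve 2 (λ s t → s :* con 0ℚ :+ t :* con 0ℚ := con 0ℚ) refl S′ S ⟩
        0ℚ ∎

      diagonal : combination column (coefficient n) n n ≡ S′
      diagonal = begin
        combination column (coefficient n) n n
          ≡⟨ combination≡moments n n ⟩
        S′ * moment n n + S * moment (suc n) n
          ≡⟨ cong₂ (λ s t → S′ * s + S * t) (moment-diagonal n) (moment-below (suc n) n (ℕ.n<1+n n)) ⟩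
        S′ * 1ℚ + S * 0ℚ
          ≡⟨ solve 2 (λ s t → s :* con 1ℚ :+ t :* con 0ℚ := s) refl S′ S ⟩
        S′ ∎

    det≡total : ∀ n → detℚ {n} (λ i j → column (toℕ j) (toℕ i)) ≡ fromℕ (total n)
    det≡total n = begin
      detℚ {n} (λ i j → column (toℕ j) (toℕ i))
        ≡⟨ det≡minor n 0 _ (λ j → column (toℕ j)) (λ i j → cong (column (toℕ j)) (sym (ℕ.+-identityʳ (toℕ i)))) ⟩
      minor n 0 (tabulate {n = n} (λ j → column (toℕ j)))
        ≡⟨ cong (minor n 0) (tabulate∘toℕ column n) ⟩
      minor n 0 (applyUpTo column n)
        ≡⟨ minor≡total n ⟩
      fromℕ (total n) ∎

open import Data.Nat.Base using (_+_; _*_; _∸_; _≤_; NonZero; NonTrivial)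

theorem9 : (n : ℕ) → .{{_ : NonZero n}} → (k : ℕ) → .{{_ : NonTrivial k}} → (β : ℕ) → β ≤ k ∸ 1 →
    detℚ {n} (λ i j → catalan ((k ∸ 1) * toℕ i + toℕ j + β) k ℚ.+ catalan ((k ∸ 1) * toℕ i + toℕ j + β + 1) k)
    ≡ fromℕ (∑≤ n (λ s → (⌊ s + β /[ k -1]⌋ + n) C (n ∸ s)))
theorem9 n (2+ k-2) β β≤k-1 = CatalanSums.det≡total k-2 β β≤k-1 n
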